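{- Let $G$ be a finite abelian group with exponent $n\ge 2$ and let $A=[1,n-1]=\{1,2,\ldots,n-1\}$. Then $G$ is $0$-complete with respect to $A$; that is, every finite sequence $S$ over $G$ satisfies $$N_{A,0}(S)\geq 2^{|S|-D_A(G)+1}.$$
   Context: $G$ is written additively. A sequence over $G$ is a finite sequence $S=\prod_{i=1}^m g_i$ of elements of $G$ (repetition allowed, order irrelevant, i.e. an element of the free abelian monoid $\mathcal F(G)$ with basis $G$); $|S|=m$ is its length, and the empty sequence is allowed. Subsequences are identified by their index sets $I\subseteq[1,m]$. For a nonempty set $A$ of integers, none divisible by $n$, and $g\in G$, $N_{A,g}(S)$ is the number of index sets $I\subseteq [1,m]$ (including $I=\emptyset$, whose sum is by convention $0$) for which there exist $a_i\in A$ ($i\in I$) with $\sum_{i\in I}a_ig_i=g$. The $A$-weighted Davenport constant $D_A(G)$ is the smallest positive integer $l$ such that for every sequence $S=g_1\cdots g_t$ over $G$ of length $t\ge l$ there are a nonempty $I\subseteq[1,t]$ and $a_i\in A$ ($i\in I$) with $\sum_{i\in I}a_ig_i=0$. A group $G$ is $0$-complete with respect to $A$ if $N_{A,0}(S)\geq 2^{|S|-D_A(G)+1}$ for all $S\in\mathcal F(G)$. -}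

module Defs where

open import Algebra.Bundles using (AbelianGroup)
import Algebra.Definitions.RawMonoid as RawMonoidDefs
import Algebra.Properties.CommutativeMonoid.Sum as Sum
open import Data.Bool.Base using (if_then_else_)
open import Data.Fin.Base using (Fin; zero; suc)
open import Data.Fin.Properties using (inj⇒≟)
open import Data.Fin.Subset using (Subset; inside; outside; _∈_; Nonempty)
open import Data.Integer.Base as ℤ using (ℤ; +_; -[1+_]; 0ℤ; 1ℤ; +≤+)
open import Data.List.Base using (List; []; _∷_; _++_; map; filter; length)
open import Data.Nat.Base as ℕ using (ℕ; zero; suc; z≤n; s≤s)
open import Data.Nat.Properties using (anyUpTo?; m^n≢0)
open import Data.Product.Base using (∃; _×_; _,_; proj₂)
open import Data.Rational.Base as ℚ using (ℚ)
open import Data.Vec.Base using ([]; _∷_; lookup; here; there)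
open import Data.Vec.Functional using (Vector)
open import Function.Base using (_∘_)
open import Function.Bundles using (Inverse)
open import Function.Properties.Inverse using (Inverse⇒Injection)
open import Level using (0ℓ; _⊔_) renaming (suc to lsuc)
import Relation.Binary.Definitions as Binary
import Relation.Binary.PropositionalEquality.Properties as ≡
open import Relation.Nullary.Decidable using (Dec; map′)
open import Relation.Unary using (Pred; Decidable)

2^ℤ : ℤ → ℚ
2^ℤ (+ k)    = + (2 ℕ.^ k) ℚ./ 1
2^ℤ -[1+ k ] = (+ 1 ℚ./ (2 ℕ.^ suc k)) {{m^n≢0 2 (suc k)}}

IsLeastPositive : ∀ {p} → Pred ℕ p → Pred ℕ p
IsLeastPositive P n = 1 ℕ.≤ n × P n × (∀ k → 1 ℕ.≤ k → P k → n ℕ.≤ k)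

allSubsets : ∀ m → List (Subset m)
allSubsets zero    = [] ∷ []
allSubsets (suc m) = map (outside ∷_) (allSubsets m) ++ map (inside ∷_) (allSubsets m)

⟦1,_⟧ : ℕ → Pred ℤ 0ℓ
⟦1, k ⟧ a = 1ℤ ℤ.≤ a × a ℤ.≤ + k

-- The number of index sets representing a given element is only computable
-- once "some a ∈ A satisfies P" is decidable for every decidable P.
Searchable : ∀ p → Pred ℤ 0ℓ → Set (lsuc p)
Searchable p A = {P : Pred ℤ p} → Decidable P → Dec (∃ λ a → A a × P a)

⟦1,_⟧-searchable : ∀ {p} k → Searchable p ⟦1, k ⟧
⟦1, k ⟧-searchable {P = P} P? = map′ to from (anyUpTo? (P? ∘ +_ ∘ suc) k)
  where
  to : (∃ λ i → i ℕ.< k × P (+ suc i)) → ∃ λ a → ⟦1, k ⟧ a × P a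
  to (i , i<k , p) = + suc i , (+≤+ (s≤s z≤n) , +≤+ i<k) , p

  from : (∃ λ a → ⟦1, k ⟧ a × P a) → ∃ λ i → i ℕ.< k × P (+ suc i)
  from (.(+ suc i) , (+≤+ {n = suc i} (s≤s z≤n) , +≤+ i<k) , p) = i , i<k , p

module _ {c ℓ} (G : AbelianGroup c ℓ) where

  open AbelianGroup G
    renaming (_∙_ to _+_; ε to 0#; _⁻¹ to -_; ∙-congˡ to +-congˡ; ∙-congʳ to +-congʳ;
              identityˡ to +-identityˡ; assoc to +-assoc; inverseˡ to -‿inverseˡ; inverseʳ to -‿inverseʳ)
  open RawMonoidDefs rawMonoid using () renaming (_×_ to _×ℕ_)
  open Sum commutativeMonoid using (sum-syntax)

  Finite : Set (c ⊔ ℓ)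
  Finite = ∃ λ k → Inverse setoid (≡.setoid (Fin k))

  infixr 8 _·_

  _·_ : ℤ → Carrier → Carrier
  (+ k)    · x = k ×ℕ x
  -[1+ k ] · x = - (suc k ×ℕ x)

  IsExponent : ℕ → Set (c ⊔ ℓ)
  IsExponent = IsLeastPositive (λ n → ∀ x → (+ n) · x ≈ 0#)

  weightedSum : ∀ {m} → Vector ℤ m → Vector Carrier m → Subset m → Carrier
  weightedSum {m} a S I = ∑[ i < m ] (if lookup I i then a i · S i else 0#)

  -- The entries of a outside I are irrelevant and unconstrained.
  Represents : ∀ {m} → Pred ℤ 0ℓ → Carrier → Vector Carrier m → Pred (Subset m) ℓ
  Represents {m} A g S I =
    ∃ λ (a : Vector ℤ m) → (∀ i → i ∈ I → A (a i)) × weightedSum a S I ≈ g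

  HasZeroSum : ∀ {m} → Pred ℤ 0ℓ → Vector Carrier m → Set ℓ
  HasZeroSum A S = ∃ λ I → Nonempty I × Represents A 0# S I

  IsDavenport : Pred ℤ 0ℓ → ℕ → Set (c ⊔ ℓ)
  IsDavenport A =
    IsLeastPositive (λ l → ∀ {t} → l ℕ.≤ t → (S : Vector Carrier t) → HasZeroSum A S)

  module _ (finite : Finite) (A : Pred ℤ 0ℓ) (search : Searchable ℓ A) where

    _≟_ : Binary.Decidable _≈_
    _≟_ = inj⇒≟ (Inverse⇒Injection (proj₂ finite))

    represents? : ∀ {m} g (S : Vector Carrier m) → Decidable (Represents A g S)
    represents? g S [] =
      map′ (λ 0≈g → (λ ()) , (λ _ ()) , 0≈g) (λ (_ , _ , 0≈g) → 0≈g) (0# ≟ g)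
    represents? g S (outside ∷ I) = map′ to from (represents? g (S ∘ suc) I)
      where
      to : Represents A g (S ∘ suc) I → Represents A g S (outside ∷ I)
      to (a , a∈A , eq) =
        (λ { zero → 0ℤ ; (suc i) → a i }) ,
        (λ { (suc i) (there i∈I) → a∈A i i∈I }) ,
        trans (+-identityˡ _) eq

      from : Represents A g S (outside ∷ I) → Represents A g (S ∘ suc) I
      from (a , a∈A , eq) =
        a ∘ suc , (λ i i∈I → a∈A (suc i) (there i∈I)) , trans (sym (+-identityˡ _)) eq
    represents? g S (inside ∷ I) =
      map′ to from (search (λ b → represents? (- (b · S zero) + g) (S ∘ suc) I))
      where
      Rest : Pred ℤ ℓ
      Rest b = Represents A (- (b · S zero) + g) (S ∘ suc) I

      to : (∃ λ b → A b × Rest b) → Represents A g S (inside ∷ I)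
      to (b , b∈A , a , a∈A , eq) =
        (λ { zero → b ; (suc i) → a i }) ,
        (λ { zero here → b∈A ; (suc i) (there i∈I) → a∈A i i∈I }) ,
        trans (+-congˡ eq)
          (trans (sym (+-assoc _ _ _)) (trans (+-congʳ (-‿inverseʳ _)) (+-identityˡ g)))

      from : Represents A g S (inside ∷ I) → ∃ λ b → A b × Rest b
      from (a , a∈A , eq) =
        a zero , a∈A zero here , a ∘ suc , (λ i i∈I → a∈A (suc i) (there i∈I)) ,
        trans (sym (trans (sym (+-assoc _ _ _)) (trans (+-congʳ (-‿inverseˡ _)) (+-identityˡ _))))
          (+-congˡ eq)

    N : ∀ {m} → Carrier → Vector Carrier m → ℕ
    N {m} g S = length (filter (represents? g S) (allSubsets m))

    -- D_A(G) is specified by IsDavenport, so it enters as the (unique) such d.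
    -- The exponent of 2 is an integer, possibly negative: no truncated subtraction.
    ZeroComplete : Set (c ⊔ ℓ)
    ZeroComplete = ∀ d → IsDavenport A d → ∀ m (S : Vector Carrier m) →
      2^ℤ (+ m ℤ.- + d ℤ.+ 1ℤ) ℚ.≤ + N 0# S ℚ./ 1

{-# OPTIONS --safe #-}
-- Call a set J of indices independent if no nonempty subset of J represents 0, and let J be a
-- maximal independent set. By definition of the Davenport constant, |J| < D_A(G). By maximality,
-- every i ∉ J is the only index outside J of some set representing 0. Representations of 0 can be
-- added modulo the exponent n, and a coefficient that becomes 0 mod n simply drops its index.
-- Hence every T ⊆ ∁ J is the part outside J of some set representing 0, so that
-- N(S) ≥ 2^(|S| - |J|) ≥ 2^(|S| - D_A(G) + 1).
module Submission where

open import Algebra.Bundles using (AbelianGroup)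
open import Data.Nat using (ℕ; _≤_; _∸_)
open import Defs

import Algebra.Properties.CommutativeSemigroup as CommutativeSemigroupProperties
import Algebra.Properties.Monoid.Mult as Mult
open import Data.Fin.Base using (zero; suc)
open import Data.Fin.Subset using (Subset; inside; outside; _∉_; _⊆_; Nonempty; ∣_∣; ∁)
open import Data.Fin.Subset.Properties
  using (anySubset?; _⊆?_; drop-∷-⊆; out⊆; in⊆in; drop-there; ∣p∣≤n; ∣∁p∣≡n∸∣p∣)
open import Data.Integer.Base as ℤ using (ℤ; +_; 0ℤ; 1ℤ; +≤+; -≤+)
import Data.Integer.Properties as ℤ
open import Data.List.Base using ([]; _∷_; _++_; map; filter; length)
open import Data.List.Properties using (filter-++; length-++)
open import Data.Nat.Base using (zero; suc; z≤n; s≤s; _<_; _+_; _*_; _^_; NonZero; >-nonZero)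
open import Data.Nat.DivMod using (_%_; _/_; m≡m%n+[m/n]*n; m%n<n)
import Data.Nat.Properties as ℕ
open import Data.Product.Base using (∃; _×_; _,_)
import Data.Rational.Base as ℚ
import Data.Rational.Properties as ℚ
import Data.Rational.Unnormalised.Base as ℚᵘ
import Data.Rational.Unnormalised.Properties as ℚᵘ
open import Data.Sum.Base using (inj₁; inj₂)
open import Data.Vec.Base using ([]; _∷_; lookup; here; there)
open import Data.Vec.Functional using (Vector)
open import Function.Base using (_∘_)
open import Level using (Level; 0ℓ; _⊔_)
open import Relation.Binary.PropositionalEquality as ≡ using (_≡_; cong; cong₂)
import Relation.Binary.Reasoning.Setoid as SetoidReasoning
open import Relation.Nullary.Decidable using (yes; no; _×-dec_)
open import Relation.Nullary.Negation using (¬_; contradiction)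
open import Relation.Unary using (Pred; Decidable; _∪_)
open import Relation.Unary.Properties using (_∪?_)

private
  variable
    a p q : Level
    m : ℕ

-- Counting the subsets that satisfy a predicate

length-filter-map : ∀ {A : Set a} {B : Set q} {P : Pred B p} (P? : Decidable P) (f : A → B) xs →
  length (filter P? (map f xs)) ≡ length (filter (P? ∘ f) xs)
length-filter-map P? f [] = ≡.refl
length-filter-map P? f (x ∷ xs) with P? (f x)
... | yes _ = cong suc (length-filter-map P? f xs)
... | no  _ = length-filter-map P? f xs

length-filter-∪ : ∀ {A : Set a} {P : Pred A p} {Q : Pred A q}
  (P? : Decidable P) (Q? : Decidable Q) xs →
  length (filter (P? ∪? Q?) xs) ≤ length (filter P? xs) + length (filter Q? xs)
length-filter-∪ P? Q? [] = z≤n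
length-filter-∪ P? Q? (x ∷ xs) with P? x | Q? x
... | yes _ | yes _ = s≤s (ℕ.≤-trans (length-filter-∪ P? Q? xs) (ℕ.+-monoʳ-≤ _ (ℕ.n≤1+n _)))
... | yes _ | no  _ = s≤s (length-filter-∪ P? Q? xs)
... | no  _ | yes _ = ℕ.≤-trans (s≤s (length-filter-∪ P? Q? xs)) (ℕ.≤-reflexive (≡.sym (ℕ.+-suc _ _)))
... | no  _ | no  _ = length-filter-∪ P? Q? xs

AgreeOff : Subset m → Subset m → Subset m → Set
AgreeOff J I T = ∀ {i} → i ∉ J → lookup I i ≡ lookup T i

AgreeOff-tail : ∀ {J I T : Subset m} {x y z} → AgreeOff (x ∷ J) (y ∷ I) (z ∷ T) → AgreeOff J I T
AgreeOff-tail agree i∉J = agree (i∉J ∘ drop-there)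

AgreeOff-out : ∀ {J I T : Subset m} x → AgreeOff J I T → AgreeOff (outside ∷ J) (x ∷ I) (x ∷ T)
AgreeOff-out x agree {zero}  _   = ≡.refl
AgreeOff-out x agree {suc i} i∉J = agree (i∉J ∘ there)

AgreeOff-in : ∀ {J I T : Subset m} {x y} → AgreeOff J I T → AgreeOff (inside ∷ J) (x ∷ I) (y ∷ T)
AgreeOff-in agree {zero}  0∉J = contradiction here 0∉J
AgreeOff-in agree {suc i} i∉J = agree (i∉J ∘ there)

nonempty-∷ : ∀ {I : Subset m} {x} → Nonempty I → Nonempty (x ∷ I)
nonempty-∷ (i , i∈I) = suc i , there i∈I

nonempty-out⁻ : ∀ {I : Subset m} → Nonempty (outside ∷ I) → Nonempty I
nonempty-out⁻ (suc i , there i∈I) = i , i∈I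

length-filter-allSubsets : ∀ {P : Pred (Subset (suc m)) p} (P? : Decidable P) →
  length (filter P? (allSubsets (suc m))) ≡
  length (filter (P? ∘ (outside ∷_)) (allSubsets m)) + length (filter (P? ∘ (inside ∷_)) (allSubsets m))
length-filter-allSubsets {m} P? = begin
  length (filter P? (outs ++ ins))
    ≡⟨ cong length (filter-++ P? outs ins) ⟩
  length (filter P? outs ++ filter P? ins)
    ≡⟨ length-++ (filter P? outs) ⟩
  length (filter P? outs) + length (filter P? ins)
    ≡⟨ cong₂ _+_ (length-filter-map P? _ (allSubsets m)) (length-filter-map P? _ (allSubsets m)) ⟩
  length (filter (P? ∘ (outside ∷_)) (allSubsets m)) + length (filter (P? ∘ (inside ∷_)) (allSubsets m)) ∎
  where
  open ≡.≡-Reasoning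
  outs = map (outside ∷_) (allSubsets m)
  ins  = map (inside ∷_) (allSubsets m)

-- The sets satisfying `P` realise every trace on `∁ J`, and there are `2 ^ ∣ ∁ J ∣` traces. In the
-- induction, an index off `J` splits the count into two halves that each inherit the hypothesis; at
-- an index of `J` the two halves are merged into one union, whose count is at most the sum of
-- theirs.
length-filter-≥ : ∀ {P : Pred (Subset m) p} (P? : Decidable P) J →
  (∀ T → ∃ λ I → AgreeOff J I T × P I) → 2 ^ ∣ ∁ J ∣ ≤ length (filter P? (allSubsets m))
length-filter-≥ P? [] extend with P? [] | extend []
... | yes _  | _           = s≤s z≤n
... | no ¬p  | [] , _ , pI = contradiction pI ¬p
length-filter-≥ {suc m} {P = P} P? (outside ∷ J) extend = begin
  2 ^ ∣ ∁ J ∣ + (2 ^ ∣ ∁ J ∣ + 0)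
    ≡⟨ cong (λ k → 2 ^ ∣ ∁ J ∣ + k) (ℕ.+-identityʳ _) ⟩
  2 ^ ∣ ∁ J ∣ + 2 ^ ∣ ∁ J ∣
    ≤⟨ ℕ.+-mono-≤ (length-filter-≥ (P? ∘ (outside ∷_)) J (extend′ outside))
                  (length-filter-≥ (P? ∘ (inside ∷_)) J (extend′ inside)) ⟩
  length (filter (P? ∘ (outside ∷_)) (allSubsets m)) + length (filter (P? ∘ (inside ∷_)) (allSubsets m))
    ≡⟨ length-filter-allSubsets P? ⟨
  length (filter P? (allSubsets (suc m))) ∎
  where
  open ℕ.≤-Reasoning
  extend′ : ∀ x T → ∃ λ I → AgreeOff J I T × P (x ∷ I)
  extend′ x T with extend (x ∷ T)
  ... | y ∷ I , agree , pI with ≡.refl ← agree {zero} (λ ()) = I , AgreeOff-tail agree , pI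
length-filter-≥ {suc m} {P = P} P? (inside ∷ J) extend = begin
  2 ^ ∣ ∁ J ∣
    ≤⟨ length-filter-≥ ((P? ∘ (outside ∷_)) ∪? (P? ∘ (inside ∷_))) J extend′ ⟩
  length (filter ((P? ∘ (outside ∷_)) ∪? (P? ∘ (inside ∷_))) (allSubsets m))
    ≤⟨ length-filter-∪ (P? ∘ (outside ∷_)) (P? ∘ (inside ∷_)) (allSubsets m) ⟩
  length (filter (P? ∘ (outside ∷_)) (allSubsets m)) + length (filter (P? ∘ (inside ∷_)) (allSubsets m))
    ≡⟨ length-filter-allSubsets P? ⟨
  length (filter P? (allSubsets (suc m))) ∎
  where
  open ℕ.≤-Reasoning
  extend′ : ∀ T → ∃ λ I → AgreeOff J I T × ((P ∘ (outside ∷_)) ∪ (P ∘ (inside ∷_))) I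
  -- Position zero lies in `J`, so the head given to `T` is arbitrary and that of the answer may be
  -- either.
  extend′ T with extend (outside ∷ T)
  ... | outside ∷ I , agree , pI = I , AgreeOff-tail agree , inj₁ pI
  ... | inside  ∷ I , agree , pI = I , AgreeOff-tail agree , inj₂ pI

-- Powers of two with integer exponents

-- Cross-multiplication is immediate only for unnormalised fractions, since `ℚ./` cancels common
-- factors; hence the passage through `ℚᵘ`.
/-mono-≤ : ∀ i j k l .{{_ : NonZero j}} .{{_ : NonZero l}} →
  i ℤ.* + l ℤ.≤ k ℤ.* + j → i ℚ./ j ℚ.≤ k ℚ./ l
/-mono-≤ i (suc j) k (suc l) il≤kj = ℚ.toℚᵘ-cancel-≤ (begin
  ℚ.toℚᵘ (i ℚ./ suc j)  ≃⟨ ℚ.toℚᵘ-fromℚᵘ (ℚᵘ.mkℚᵘ i j) ⟩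
  ℚᵘ.mkℚᵘ i j           ≤⟨ ℚᵘ.*≤* il≤kj ⟩
  ℚᵘ.mkℚᵘ k l           ≃⟨ ℚ.toℚᵘ-fromℚᵘ (ℚᵘ.mkℚᵘ k l) ⟨
  ℚ.toℚᵘ (k ℚ./ suc l)  ∎)
  where open ℚᵘ.≤-Reasoning

-- A nonnegative exponent is handled by monotonicity of powers. For a negative one the left side is
-- below 1, while `N` is at least `2 ^ k` and so at least 1.
2^ℤ-≤ : ∀ {e k N} → e ℤ.≤ + k → 2 ^ k ≤ N → 2^ℤ e ℚ.≤ + N ℚ./ 1
2^ℤ-≤ {k = k} {N} (+≤+ {m = j} j≤k) 2^k≤N =
  /-mono-≤ (+ (2 ^ j)) 1 (+ N) 1
    (ℤ.*-monoʳ-≤-nonNeg (+ 1) (+≤+ (ℕ.≤-trans (ℕ.^-monoʳ-≤ 2 j≤k) 2^k≤N)))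
2^ℤ-≤ {k = k} {N} (-≤+ {m = j}) 2^k≤N =
  /-mono-≤ (+ 1) (2 ^ suc j) (+ N) 1 {{ℕ.m^n≢0 2 (suc j)}}
    (≡.subst (+ 1 ℤ.≤_) (ℤ.pos-* N (2 ^ suc j))
      (+≤+ (ℕ.*-mono-≤ {1} {N} {1} (ℕ.≤-trans (ℕ.m^n>0 2 k) 2^k≤N) (ℕ.m^n>0 2 (suc j)))))

-- The strict inequality `j < d` absorbs the added 1, and `j ≤ m` makes the truncated subtraction
-- exact.
m-d+1≤m∸j : ∀ {j d} m → j < d → j ≤ m → + m ℤ.- + d ℤ.+ 1ℤ ℤ.≤ + (m ∸ j)
m-d+1≤m∸j {j} {suc d} m (s≤s j≤d) j≤m = begin
  + m ℤ.- + suc d ℤ.+ 1ℤ  ≡⟨ cong (ℤ._+ 1ℤ) (ℤ.m-n≡m⊖n m (suc d)) ⟩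
  m ℤ.⊖ suc d ℤ.+ 1ℤ      ≡⟨ ℤ.distribˡ-⊖-+-pos 1 m (suc d) ⟩
  m + 1 ℤ.⊖ suc d         ≡⟨ cong (ℤ._⊖ suc d) (ℕ.+-comm m 1) ⟩
  suc m ℤ.⊖ suc d         ≡⟨ ℤ.[1+m]⊖[1+n]≡m⊖n m d ⟩
  m ℤ.⊖ d                 ≤⟨ ℤ.⊖-monoʳ-≥-≤ m j≤d ⟩
  m ℤ.⊖ j                 ≡⟨ ℤ.⊖-≥ j≤m ⟩
  + (m ∸ j)               ∎
  where open ℤ.≤-Reasoning

-- Representations and subsequences

module _ {c ℓ} (G : AbelianGroup c ℓ) where

  open AbelianGroup G renaming (_∙_ to _⊕_; ε to 0#)
  open CommutativeSemigroupProperties commutativeSemigroup using (interchange; x∙yz≈y∙xz)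
  open Mult monoid using ()
    renaming (_×_ to _×ℕ_; ×-homo-+ to ×ℕ-homo-+; ×-congˡ to ×ℕ-congˡ; ×-assocˡ to ×ℕ-assocˡ)

  private
    variable
      A : Pred ℤ 0ℓ
      b : ℤ
      g h : Carrier
      S : Vector Carrier m
      I J : Subset m

  -- Represents G A g S I in inductive form, where S and I can be inferred.
  data Rep (A : Pred ℤ 0ℓ) (g : Carrier) : Vector Carrier m → Subset m → Set (c ⊔ ℓ) where
    empty : 0# ≈ g → Rep A g {zero} S []
    skip  : Rep A g (S ∘ suc) I → Rep A g S (outside ∷ I)
    take  : A b → Rep A h (S ∘ suc) I → _·_ G b (S zero) ⊕ h ≈ g → Rep A g S (inside ∷ I)

  Rep⇒Represents : Rep A g S I → Represents G A g S I
  Rep⇒Represents (empty 0≈g) = (λ ()) , (λ _ ()) , 0≈g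
  Rep⇒Represents (skip r) = let a , a∈A , eq = Rep⇒Represents r in
    (λ { zero → 0ℤ ; (suc i) → a i }) ,
    (λ { (suc i) (there i∈I) → a∈A i i∈I }) ,
    trans (identityˡ _) eq
  Rep⇒Represents (take {b = b} b∈A r b·s+h≈g) = let a , a∈A , eq = Rep⇒Represents r in
    (λ { zero → b ; (suc i) → a i }) ,
    (λ { zero here → b∈A ; (suc i) (there i∈I) → a∈A i i∈I }) ,
    trans (∙-congˡ eq) b·s+h≈g

  Represents⇒Rep : (S : Vector Carrier m) (I : Subset m) → Represents G A g S I → Rep A g S I
  Represents⇒Rep S [] (_ , _ , 0≈g) = empty 0≈g
  Represents⇒Rep S (outside ∷ I) (a , a∈A , eq) =
    skip (Represents⇒Rep (S ∘ suc) I
      (a ∘ suc , (λ i i∈I → a∈A (suc i) (there i∈I)) , trans (sym (identityˡ _)) eq))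
  Represents⇒Rep S (inside ∷ I) (a , a∈A , eq) =
    take (a∈A zero here)
      (Represents⇒Rep (S ∘ suc) I (a ∘ suc , (λ i i∈I → a∈A (suc i) (there i∈I)) , refl)) eq

  Rep-resp : g ≈ h → Rep A g S I → Rep A h S I
  Rep-resp g≈h (empty 0≈g)          = empty (trans 0≈g g≈h)
  Rep-resp g≈h (skip r)             = skip (Rep-resp g≈h r)
  Rep-resp g≈h (take b∈A r b·s+k≈g) = take b∈A r (trans b·s+k≈g g≈h)

  restrict : (J : Subset m) → Vector Carrier m → Vector Carrier ∣ J ∣
  restrict (outside ∷ J) S i       = restrict J (S ∘ suc) i
  restrict (inside  ∷ J) S zero    = S zero
  restrict (inside  ∷ J) S (suc i) = restrict J (S ∘ suc) i

  -- Carries a representation over the subsequence indexed by `J` back to the whole sequence.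
  -- Nonemptiness is an implication because the induction passes through tails that may be empty.
  Rep-restrict : (J : Subset m) {I : Subset ∣ J ∣} → Rep A g (restrict J S) I →
    ∃ λ I′ → I′ ⊆ J × (Nonempty I → Nonempty I′) × Rep A g S I′
  Rep-restrict [] (empty 0≈g) = [] , (λ ()) , (λ ()) , empty 0≈g
  Rep-restrict (outside ∷ J) r =
    let I′ , I′⊆J , ne , r′ = Rep-restrict J r
    in outside ∷ I′ , out⊆ I′⊆J , nonempty-∷ ∘ ne , skip r′
  Rep-restrict (inside ∷ J) (skip r) =
    let I′ , I′⊆J , ne , r′ = Rep-restrict J r
    in outside ∷ I′ , out⊆ I′⊆J , nonempty-∷ ∘ ne ∘ nonempty-out⁻ , skip r′
  Rep-restrict (inside ∷ J) (take b∈A r eq) =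
    let I′ , I′⊆J , _ , r′ = Rep-restrict J r
    in inside ∷ I′ , in⊆in I′⊆J , (λ _ → zero , here) , take b∈A r′ eq

  -- Independent index sets

  Independent : Pred ℤ 0ℓ → Vector Carrier m → Subset m → Set (c ⊔ ℓ)
  Independent A S J = ∀ {I} → I ⊆ J → Nonempty I → ¬ Rep A 0# S I

  ∣independent∣<davenport : ∀ {d} → IsDavenport G A d → Independent A S J → ∣ J ∣ < d
  ∣independent∣<davenport {S = S} {J = J} (_ , hasZeroSum , _) independent =
    ℕ.≰⇒> λ d≤∣J∣ →
      let I , I≢∅ , r         = hasZeroSum d≤∣J∣ (restrict J S)
          I′ , I′⊆J , ne , r′ = Rep-restrict J (Represents⇒Rep (restrict J S) I r)
      in independent I′⊆J (ne I≢∅) r′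

  Independent-out : Independent A (S ∘ suc) J → Independent A S (outside ∷ J)
  Independent-out ind I⊆J ne (skip r)     = ind (drop-∷-⊆ I⊆J) (nonempty-out⁻ ne) r
  Independent-out ind I⊆J ne (take _ _ _) with () ← I⊆J here

  -- A zero sum within the enlarged set either avoids the new index, against `ind`, or uses it
  -- together with a subset of `J`, against `none`.
  Independent-in : (¬ ∃ λ I → I ⊆ J × Represents G A 0# S (inside ∷ I)) →
    Independent A (S ∘ suc) J → Independent A S (inside ∷ J)
  Independent-in none ind I⊆J ne (skip r)       = ind (drop-∷-⊆ I⊆J) (nonempty-out⁻ ne) r
  Independent-in none ind I⊆J ne r@(take _ _ _) = none (_ , drop-∷-⊆ I⊆J , Rep⇒Represents r)

  -- Adding representations modulo the exponent

  module _ (n : ℕ) .{{_ : NonZero n}} (n×x≈0 : ∀ x → n ×ℕ x ≈ 0#) where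

    open SetoidReasoning setoid

    ×ℕ-% : ∀ k x → k ×ℕ x ≈ (k % n) ×ℕ x
    ×ℕ-% k x = begin
      k ×ℕ x                              ≈⟨ ×ℕ-congˡ (m≡m%n+[m/n]*n k n) ⟩
      (k % n + k / n * n) ×ℕ x            ≈⟨ ×ℕ-homo-+ x (k % n) (k / n * n) ⟩
      (k % n) ×ℕ x ⊕ (k / n * n) ×ℕ x     ≈⟨ ∙-congˡ (×ℕ-congˡ (ℕ.*-comm (k / n) n)) ⟩
      (k % n) ×ℕ x ⊕ (n * (k / n)) ×ℕ x   ≈⟨ ∙-congˡ (×ℕ-assocˡ x n (k / n)) ⟨
      (k % n) ×ℕ x ⊕ n ×ℕ ((k / n) ×ℕ x)  ≈⟨ ∙-congˡ (n×x≈0 _) ⟩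
      (k % n) ×ℕ x ⊕ 0#                   ≈⟨ identityʳ _ ⟩
      (k % n) ×ℕ x                        ∎

    -- Here the shape of the weight set enters: every nonzero residue modulo `n` is an admissible
    -- coefficient, and residue 0 is the same as leaving the index out.
    Rep-∷ : ∀ k → Rep ⟦1, n ∸ 1 ⟧ h (S ∘ suc) I → k ×ℕ S zero ⊕ h ≈ g →
      ∃ λ x → Rep ⟦1, n ∸ 1 ⟧ g S (x ∷ I)
    Rep-∷ {S = S} k r eq with k % n | m%n<n k n | ×ℕ-% k (S zero)
    ... | zero  | _     | k×s≈0 =
      outside , skip (Rep-resp (trans (sym (trans (∙-congʳ k×s≈0) (identityˡ _))) eq) r)
    ... | suc j | 1+j<n | k×s≈  =
      inside ,
      take (+≤+ (s≤s z≤n) , +≤+ (ℕ.∸-monoˡ-≤ 1 1+j<n)) r (trans (∙-congʳ (sym k×s≈)) eq)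

    -- Coefficients are added index by index. Where both sets meet they may cancel modulo `n`, so
    -- `K` is not controlled on `I`; off `I` only the second summand contributes, so `K` agrees with
    -- `J` there.
    Rep-⊕ : Rep ⟦1, n ∸ 1 ⟧ g S I → Rep ⟦1, n ∸ 1 ⟧ h S J →
      ∃ λ K → AgreeOff I K J × Rep ⟦1, n ∸ 1 ⟧ (g ⊕ h) S K
    Rep-⊕ (empty 0≈g) (empty 0≈h) =
      [] , (λ _ → ≡.refl) , empty (trans (sym (identityˡ _)) (∙-cong 0≈g 0≈h))
    Rep-⊕ (skip r) (skip r′) =
      let K , agree , t = Rep-⊕ r r′
      in outside ∷ K , AgreeOff-out outside agree , skip t
    Rep-⊕ (skip r) (take b∈A r′ eq) =
      let K , agree , t = Rep-⊕ r r′
      in inside ∷ K , AgreeOff-out inside agree ,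
         take b∈A t (trans (x∙yz≈y∙xz _ _ _) (∙-congˡ eq))
    Rep-⊕ (take b∈A r eq) (skip r′) =
      let K , agree , t = Rep-⊕ r r′
      in inside ∷ K , AgreeOff-in agree ,
         take b∈A t (trans (sym (assoc _ _ _)) (∙-congʳ eq))
    Rep-⊕ {g = g} {S = S} {h = h}
          -- The bound `1 ≤ b` rules out negative integers, so both coefficients are naturals.
          (take {b = + j} {h = g′} (+≤+ _ , _) r eq) (take {b = + k} {h = h′} (+≤+ _ , _) r′ eq′) =
      let K , agree , t = Rep-⊕ r r′
          x , u         = Rep-∷ (j + k) t (begin
            (j + k) ×ℕ S zero ⊕ (g′ ⊕ h′)            ≈⟨ ∙-congʳ (×ℕ-homo-+ (S zero) j k) ⟩
            (j ×ℕ S zero ⊕ k ×ℕ S zero) ⊕ (g′ ⊕ h′)  ≈⟨ interchange _ _ g′ h′ ⟩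
            (j ×ℕ S zero ⊕ g′) ⊕ (k ×ℕ S zero ⊕ h′)  ≈⟨ ∙-cong eq eq′ ⟩
            g ⊕ h                                    ∎)
      in x ∷ K , AgreeOff-in agree , u

    -- The maximal independent set

    -- Greedy construction from the last index to the first: an index joins `J` unless it completes
    -- a zero sum with some subset of `J`. Maximality is recorded through its consequence, that
    -- every trace off `J` extends to a zero sum.
    maximalIndependent : Finite G → (S : Vector Carrier m) →
      ∃ λ J → Independent ⟦1, n ∸ 1 ⟧ S J ×
              (∀ T → ∃ λ I → AgreeOff J I T × Rep ⟦1, n ∸ 1 ⟧ 0# S I)
    maximalIndependent {zero} _ S =
      [] , (λ { _ (() , _) }) , λ { [] → [] , (λ _ → ≡.refl) , empty refl }
    maximalIndependent {suc m} finite S with maximalIndependent finite (S ∘ suc)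
    ... | J , ind , extend
      with anySubset? (λ I → (I ⊆? J) ×-dec
             represents? G finite ⟦1, n ∸ 1 ⟧ ⟦1, n ∸ 1 ⟧-searchable 0# S (inside ∷ I))
    ...   | no none = inside ∷ J , Independent-in none ind , extend′
      where
      extend′ : ∀ T → ∃ λ I → AgreeOff (inside ∷ J) I T × Rep ⟦1, n ∸ 1 ⟧ 0# S I
      extend′ (_ ∷ T) =
        let I , agree , r = extend T
        in outside ∷ I , AgreeOff-in agree , skip r
    ...   | yes (I₀ , I₀⊆J , r₀) = outside ∷ J , Independent-out ind , extend′
      where
      extend′ : ∀ T → ∃ λ I → AgreeOff (outside ∷ J) I T × Rep ⟦1, n ∸ 1 ⟧ 0# S I
      extend′ (outside ∷ T) =
        let I , agree , r = extend T
        in outside ∷ I , AgreeOff-out outside agree , skip r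
      extend′ (inside ∷ T) with Represents⇒Rep S (inside ∷ I₀) r₀
      -- `r₁` represents the inverse of the head term inside `J`. Adding the representation `r` of 0
      -- keeps that value and, since `I₀ ⊆ J`, gives the set the trace of `T` off `J`; the head term
      -- then brings the sum back to 0.
      ... | take b∈A r₁ eq =
        let I , agree , r  = extend T
            K , agree′ , t = Rep-⊕ r₁ r
        in inside ∷ K ,
           AgreeOff-out inside (λ i∉J → ≡.trans (agree′ (i∉J ∘ I₀⊆J)) (agree i∉J)) ,
           take b∈A t (trans (∙-congˡ (identityʳ _)) eq)

theorem3p4 : ∀ {c ℓ} (G : AbelianGroup c ℓ) (finite : Finite G) (n : ℕ) →
    IsExponent G n → 2 ≤ n →
    ZeroComplete G finite ⟦1, n ∸ 1 ⟧ ⟦1, n ∸ 1 ⟧-searchable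
theorem3p4 G finite n (1≤n , n×x≈0 , _) _ d isDavenport m S =
  let J , independent , extend = maximalIndependent G n {{>-nonZero 1≤n}} n×x≈0 finite S
      ∣J∣<d    = ∣independent∣<davenport G isDavenport independent
      2^∣∁J∣≤N = length-filter-≥ (represents? G finite ⟦1, n ∸ 1 ⟧ ⟦1, n ∸ 1 ⟧-searchable _ S) J
                   (λ T → let I , agree , r = extend T in I , agree , Rep⇒Represents G r)
  in 2^ℤ-≤ (m-d+1≤m∸j m ∣J∣<d (∣p∣≤n J)) (≡.subst (λ k → 2 ^ k ≤ _) (∣∁p∣≡n∸∣p∣ J) 2^∣∁J∣≤N)
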